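{- Let $r\ge 2$ be an integer and set $c_2=\frac{2}{3}$, $c_3=\frac{5}{9}$ and $c_r=\frac{r}{3r-4}$ for $r>3$. If $G$ is an $r$-uniform multi-hypergraph with $m$ edges, then there is a partition of the vertex set of $G$ into $r$ parts such that each part meets at least $c_r m$ edges.
   Context: An $r$-uniform multi-hypergraph on a finite vertex set $V$ is a finite multiset of $r$-element subsets of $V$ (edges), repeated edges being allowed and counted with multiplicity. A set $X\subseteq V$ meets an edge $e$ if $X\cap e\neq\emptyset$; the number of edges meeting $X$ is counted with multiplicity. -}

module Defs where

open import Data.Nat using (ℕ; zero; suc; _+_; _*_; _∸_; _≤_)
open import Data.Fin using (Fin)
open import Data.Fin.Subset using (Subset; ∣_∣; _∈_)
open import Data.Fin.Subset.Properties using (_∈?_)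
open import Data.List using (List; length; filter)
open import Data.List.Membership.Propositional using () renaming (_∈_ to _∈ₗ_)
open import Data.Product using (∃; _×_)
open import Relation.Binary.PropositionalEquality using (_≡_)
open import Relation.Nullary using (Dec)
open import Data.Fin.Properties using (any?; _≟_)
open import Relation.Nullary.Decidable using (_×-dec_)

-- An r-uniform multi-hypergraph on vertex set Fin n: a finite multiset
-- (represented as a list; order irrelevant, repetitions = multiplicity)
-- of r-element subsets of Fin n.
record MultiHypergraph (n r : ℕ) : Set where
  field
    edges   : List (Subset n)
    uniform : ∀ {e} → e ∈ₗ edges → ∣ e ∣ ≡ r

open MultiHypergraph public

-- A partition of the vertex set into r (labelled) parts: each vertex is
-- assigned the index of its part.  Parts may a priori be empty.
Partition : ℕ → ℕ → Set
Partition n r = Fin n → Fin r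

Meets : ∀ {n r} → Partition n r → Fin r → Subset n → Set
Meets p i e = ∃ λ v → v ∈ e × p v ≡ i

meets? : ∀ {n r} (p : Partition n r) (i : Fin r) (e : Subset n) → Dec (Meets p i e)
meets? p i e = any? (λ v → (v ∈? e) ×-dec (p v ≟ i))

meetCount : ∀ {n r} → MultiHypergraph n r → Partition n r → Fin r → ℕ
meetCount G p i = length (filter (meets? p i) (edges G))

numEdges : ∀ {n r} → MultiHypergraph n r → ℕ
numEdges G = length (edges G)

-- c_r = cNum r / cDen r :  c_2 = 2/3, c_3 = 5/9, c_r = r/(3r-4) for r > 3.
cNum : ℕ → ℕ
cNum 2 = 2
cNum 3 = 5
cNum r = r

cDen : ℕ → ℕ
cDen 2 = 3
cDen 3 = 9
cDen r = 3 * r ∸ 4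

-- "x ≥ c_r * m" written without rationals: cNum r * m ≤ cDen r * x.
AtLeastCrTimes : ℕ → ℕ → ℕ → Set
AtLeastCrTimes r m x = cNum r * m ≤ cDen r * x

{-# OPTIONS --safe #-}
module Submission where

open import Defs
open import Data.Nat using (ℕ; zero; suc; _+_; _*_; _∸_; _⊓_; _≤_; _<_; z≤n; s≤s; _≤?_; _<?_; NonZero)
open import Data.Nat.Properties hiding (_≟_)
open import Data.Nat.Tactic.RingSolver using (solve-∀)
open import Data.Bool using (Bool; true; false; _∧_; not)
open import Data.Bool.Properties using (∧-zeroʳ; ∧-identityʳ)
open import Data.Fin using (Fin; zero; suc)
open import Data.Fin.Properties using (_≟_; any?; punchInᵢ≢i)
open import Data.Fin.Subset using (Subset; ∣_∣)
open import Data.List using (List; []; _∷_; length; filter; lookup)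
open import Data.List.Membership.Propositional.Properties using (∈-lookup)
import Data.Vec as Vec
open import Data.Vec.Properties using (lookup⇒[]=)
open import Data.Vec.Functional using (removeAt; updateAt)
open import Data.Vec.Functional.Properties using (updateAt-updates; updateAt-minimal)
open import Data.Product using (Σ; ∃; _,_)
open import Data.Sum using (_⊎_; inj₁; inj₂)
open import Function using (const; _∘_)
open import Relation.Nullary using (yes; no; contradiction; does)
open import Relation.Nullary.Decidable using (_×-dec_; ¬?; dec-true; dec-false)
open import Relation.Binary.PropositionalEquality using (_≡_; _≢_; refl; sym; trans; cong; cong₂; subst; module ≡-Reasoning)
open import Algebra.Properties.Semiring.Sum +-*-semiring using (sum; sum-cong-≗; sum-replicate-zero; sum-remove; ∑-distrib-+; ∑-comm; *-distribˡ-sum; *-distribʳ-sum)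

-- Write r = k + 1 and t = c m; a part is good if it meets at least t edges.  A vertex of degree
-- at least t can be a part by itself, and deleting it leaves edges of size at least r - 1, so by
-- induction on r all degrees may be taken below t.  Choose a partition that is locally maximal for
-- the sum over the parts of min(number of edges met, 2t), and suppose that part c is bad.  Moving
-- a vertex v to c gains the edges at v missing c and loses the edges that meet the part of v only
-- in v; local maximality says gain ≤ loss.  Sum this over the vertices outside c: each of the more
-- than m - t edges missing c has at least r vertices in the r - 1 other parts, hence two vertices
-- in one of them, and this leaves no room for a second bad part.  Now move vertices into c as long
-- as their own parts stay good; gains only decrease and losses only increase, so gain ≤ loss
-- survives.  When this stops, every other part is minimal among good sets.  If x is the sum of the
-- gains over such a part and y the number of edges missing c with two or more vertices in it, then
-- x + 2y ≤ 2t: for at most two vertices because degrees are below t, for three or more because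
-- each of them is critical.  Summing over the parts, (r + 2) |{edges missing c}| ≤ 2 (r - 1) t,
-- so c is good after all.

private variable
  k m n r : ℕ

-- Finite sums of natural numbers.

sum-mono-≤ : {f g : Fin n → ℕ} → (∀ i → f i ≤ g i) → sum f ≤ sum g
sum-mono-≤ {zero}  f≤g = z≤n
sum-mono-≤ {suc n} f≤g = +-mono-≤ (f≤g zero) (sum-mono-≤ (f≤g ∘ suc))

sum-≤-* : {f : Fin n → ℕ} {b : ℕ} → (∀ i → f i ≤ b) → sum f ≤ n * b
sum-≤-* {zero}  f≤b = z≤n
sum-≤-* {suc n} f≤b = +-mono-≤ (f≤b zero) (sum-≤-* (f≤b ∘ suc))

-- The values at `i` are added crosswise because either sum may be the larger one.
sum-update : (f g : Fin n → ℕ) (i : Fin n) → (∀ j → j ≢ i → f j ≡ g j) →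
             sum f + g i ≡ sum g + f i
sum-update f g zero f≗g = begin
  f zero + sum (f ∘ suc) + g zero  ≡⟨ cong (λ s → f zero + s + g zero) (sum-cong-≗ λ j → f≗g (suc j) λ ()) ⟩
  f zero + sum (g ∘ suc) + g zero  ≡⟨ rotate (f zero) (sum (g ∘ suc)) (g zero) ⟩
  g zero + sum (g ∘ suc) + f zero  ∎
  where
  open ≡-Reasoning
  rotate : ∀ a b c → a + b + c ≡ c + b + a
  rotate = solve-∀
sum-update f g (suc i) f≗g = begin
  f zero + sum (f ∘ suc) + g (suc i)    ≡⟨ +-assoc (f zero) _ _ ⟩
  f zero + (sum (f ∘ suc) + g (suc i))  ≡⟨ cong₂ _+_ (f≗g zero λ ()) (sum-update (f ∘ suc) (g ∘ suc) i λ j j≢i → f≗g (suc j) λ { refl → j≢i refl }) ⟩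
  g zero + (sum (g ∘ suc) + f (suc i))  ≡⟨ +-assoc (g zero) _ _ ⟨
  g zero + sum (g ∘ suc) + f (suc i)    ∎
  where open ≡-Reasoning

sum-update₂ : (f g : Fin n → ℕ) (i j : Fin n) → i ≢ j → (∀ l → l ≢ i → l ≢ j → f l ≡ g l) →
              sum f + (g i + g j) ≡ sum g + (f i + f j)
sum-update₂ f g i j i≢j f≗g = begin
  sum f + (g i + g j)  ≡⟨ +-assoc (sum f) (g i) (g j) ⟨
  sum f + g i + g j    ≡⟨ cong (λ x → sum f + x + g j) (updateAt-updates i f) ⟨
  sum f + h i + g j    ≡⟨ cong (_+ g j) (sum-update f h i λ l l≢i → sym (updateAt-minimal l i f l≢i)) ⟩
  sum h + f i + g j    ≡⟨ swap (sum h) (f i) (g j) ⟩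
  sum h + g j + f i    ≡⟨ cong (_+ f i) (sum-update h g j h≗g) ⟩
  sum g + h j + f i    ≡⟨ cong (λ x → sum g + x + f i) (updateAt-minimal j i f (i≢j ∘ sym)) ⟩
  sum g + f j + f i    ≡⟨ swap (sum g) (f j) (f i) ⟩
  sum g + f i + f j    ≡⟨ +-assoc (sum g) (f i) (f j) ⟩
  sum g + (f i + f j)  ∎
  where
  open ≡-Reasoning
  h = updateAt f i (const (g i))
  swap : ∀ a b c → a + b + c ≡ a + c + b
  swap = solve-∀
  h≗g : ∀ l → l ≢ j → h l ≡ g l
  h≗g l l≢j with l ≟ i
  ... | yes refl = updateAt-updates i f
  ... | no  l≢i  = trans (updateAt-minimal l i f l≢i) (f≗g l l≢i l≢j)

sum-single : (f : Fin n → ℕ) (i : Fin n) → (∀ j → j ≢ i → f j ≡ 0) → sum f ≡ f i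
sum-single {n} f i f≡0 = begin
  sum f                         ≡⟨ +-identityʳ _ ⟨
  sum f + 0                     ≡⟨ sum-update f (const 0) i f≡0 ⟩
  sum {n} (const 0) + f i       ≡⟨ cong (_+ f i) (sum-replicate-zero n) ⟩
  f i                           ∎
  where open ≡-Reasoning

-- The zero term at `c` leaves `k` summands. This is how the parts other than `c` are counted below.
sum-skip : (f : Fin (suc k) → ℕ) (c : Fin (suc k)) {b : ℕ} → f c ≡ 0 → (∀ i → i ≢ c → f i ≤ b) →
           sum f ≤ k * b
sum-skip {k} f c {b} fc≡0 f≤b = begin
  sum f                    ≡⟨ sum-remove {i = c} f ⟩
  f c + sum (removeAt f c) ≡⟨ cong (_+ sum (removeAt f c)) fc≡0 ⟩
  sum (removeAt f c)       ≤⟨ sum-≤-* (λ j → f≤b _ (punchInᵢ≢i c j)) ⟩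
  k * b                    ∎
  where open ≤-Reasoning

-- Truncated subtraction is superadditive. An excess taken off at every vertex of a part may thus be
-- taken off the total once.
sum-∸-≤ : (f : Fin n → ℕ) (o : ℕ) → sum (λ i → f i ∸ o) ≤ sum f ∸ o
sum-∸-≤ {zero}  f o = z≤n
sum-∸-≤ {suc n} f o = begin
  (f zero ∸ o) + sum (λ i → f (suc i) ∸ o)  ≤⟨ +-monoʳ-≤ (f zero ∸ o) (sum-∸-≤ (f ∘ suc) o) ⟩
  (f zero ∸ o) + (sum (f ∘ suc) ∸ o)        ≤⟨ superadditive (f zero) (sum (f ∘ suc)) ⟩
  (f zero + sum (f ∘ suc)) ∸ o              ∎
  where
  open ≤-Reasoning
  superadditive : ∀ x y → (x ∸ o) + (y ∸ o) ≤ (x + y) ∸ o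
  superadditive x y with ≤-total o x
  ... | inj₁ o≤x = begin
    (x ∸ o) + (y ∸ o)  ≤⟨ +-monoʳ-≤ (x ∸ o) (m∸n≤m y o) ⟩
    (x ∸ o) + y        ≡⟨ +-∸-comm y o≤x ⟨
    (x + y) ∸ o        ∎
  ... | inj₂ x≤o rewrite m≤n⇒m∸n≡0 x≤o = ∸-monoˡ-≤ o (m≤n+m y x)

-- Indicators for the number of vertices that an edge has in a part.

⟦_⟧ : Bool → ℕ
⟦ false ⟧ = 0
⟦ true ⟧  = 1

⟦⟧≤1 : ∀ b → ⟦ b ⟧ ≤ 1
⟦⟧≤1 false = z≤n
⟦⟧≤1 true  = ≤-refl

δ : Fin r → Fin r → ℕ
δ i j = ⟦ does (i ≟ j) ⟧

δ-≡ : {i j : Fin r} → i ≡ j → δ i j ≡ 1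
δ-≡ i≡j = cong ⟦_⟧ (dec-true (_ ≟ _) i≡j)

δ-≢ : {i j : Fin r} → i ≢ j → δ i j ≡ 0
δ-≢ i≢j = cong ⟦_⟧ (dec-false (_ ≟ _) i≢j)

sum-δ : (j : Fin r) → sum (δ j) ≡ 1
sum-δ j = trans (sum-single (δ j) j λ i i≢j → δ-≢ (i≢j ∘ sym)) (δ-≡ {i = j} refl)

isZero isPos isOne isMany : ℕ → ℕ
isZero zero    = 1
isZero (suc _) = 0
isPos zero    = 0
isPos (suc _) = 1
isOne (suc zero) = 1
isOne _          = 0
isMany (suc (suc _)) = 1
isMany _             = 0

isPos-+ : ∀ x b → isPos (x + ⟦ b ⟧) ≡ isPos x + ⟦ b ⟧ * isZero x
isPos-+ zero    false = refl
isPos-+ zero    true  = refl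
isPos-+ (suc x) false = refl
isPos-+ (suc x) true  = refl

-- Read as a removal: an edge stops being met exactly when the removed vertex was its only one in
-- the part. `isPos-+` is the counterpart for an insertion.
isPos-+-isOne : ∀ x b → isPos (x + ⟦ b ⟧) ≡ isPos x + ⟦ b ⟧ * isOne (x + ⟦ b ⟧)
isPos-+-isOne zero    false = refl
isPos-+-isOne zero    true  = refl
isPos-+-isOne (suc x) false = refl
isPos-+-isOne (suc x) true rewrite +-comm x 1 = refl

isZero-anti : ∀ {x y} → x ≤ y → isZero y ≤ isZero x
isZero-anti {zero}  {zero}  _ = ≤-refl
isZero-anti {zero}  {suc y} _ = z≤n
isZero-anti {suc x} {suc y} _ = z≤n

-- `isOne` rises between 0 and 1 and never again, hence the assumption `1 ≤ x`.
isOne-anti : ∀ {x y} → 1 ≤ x → x ≤ y → isOne y ≤ isOne x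
isOne-anti {suc zero}    {suc zero}    _ _ = ≤-refl
isOne-anti {suc zero}    {suc (suc y)} _ _ = z≤n
isOne-anti {suc (suc x)} {suc (suc y)} _ _ = z≤n
isOne-anti {suc (suc x)} {suc zero}    _ (s≤s ())

isPos+isZero : ∀ x → isPos x + isZero x ≡ 1
isPos+isZero zero    = refl
isPos+isZero (suc x) = refl

-- `isOne x * x` is what an edge with `x` vertices in a part adds to the sum of the losses over that
-- part.
isOne*-+isMany : ∀ x → isOne x * x + isMany x ≡ isPos x
isOne*-+isMany zero          = refl
isOne*-+isMany (suc zero)    = refl
isOne*-+isMany (suc (suc x)) = refl

isOne*-+2*isMany : ∀ x → isOne x * x + 2 * isMany x ≤ x
isOne*-+2*isMany zero          = z≤n
isOne*-+2*isMany (suc zero)    = ≤-refl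
isOne*-+2*isMany (suc (suc x)) = s≤s (s≤s z≤n)

isMany-≤ : ∀ x → isMany x ≤ x
isMany-≤ zero          = z≤n
isMany-≤ (suc zero)    = z≤n
isMany-≤ (suc (suc x)) = s≤s z≤n

isZero*- : ∀ x → isZero x * x ≡ 0
isZero*- zero    = refl
isZero*- (suc x) = refl

isZero*isMany : ∀ x → isZero x * isMany x ≡ 0
isZero*isMany zero    = refl
isZero*isMany (suc x) = refl

isZero-≤1 : ∀ x → isZero x ≤ 1
isZero-≤1 zero    = ≤-refl
isZero-≤1 (suc x) = z≤n

1≤isMany : ∀ {x} → 2 ≤ x → 1 ≤ isMany x
1≤isMany (s≤s (s≤s _)) = ≤-refl

term-≤-sum : (f : Fin n → ℕ) (i : Fin n) → f i ≤ sum f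
term-≤-sum f zero    = m≤m+n _ _
term-≤-sum f (suc i) = ≤-trans (term-≤-sum (f ∘ suc) i) (m≤n+m _ _)

-- Otherwise each of the `k` parts other than `c` holds at most one vertex, which makes at most `k`
-- in all.
isMany-pigeonhole : (x : Fin (suc k) → ℕ) (c : Fin (suc k)) → x c ≡ 0 → suc k ≤ sum x →
             1 ≤ sum (λ i → isMany (x i))
isMany-pigeonhole {k} x c xc≡0 big with any? (λ i → 2 ≤? x i)
... | yes (i , 2≤xi) = ≤-trans (1≤isMany 2≤xi) (term-≤-sum (λ i → isMany (x i)) i)
... | no  none = contradiction (≤-trans big small) (<-irrefl refl)
  where
  small : sum x ≤ k
  small = subst (sum x ≤_) (*-identityʳ k)
    (sum-skip x c xc≡0 λ i _ → ≤-pred (≰⇒> λ 2≤xi → none (i , 2≤xi)))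

-- Local search: every improvement costs one unit of fuel and keeps `bound ≤ value x + fuel`. With
-- no fuel left the value has reached the bound, so no improvement exists. Both the local maximum
-- and the trimming come from this.
ascend : {X : Set} {Stop : X → Set} (value : X → ℕ) (bound : ℕ) → (∀ x → value x ≤ bound) →
         (∀ x → Stop x ⊎ ∃ λ y → value x < value y) → X → ∃ Stop
ascend {X} {Stop} value bound value≤bound step x₀ = go bound x₀ (m≤n+m bound (value x₀))
  where
  go : ∀ fuel x → bound ≤ value x + fuel → ∃ Stop
  go fuel x enough with step x
  ... | inj₁ stop = x , stop
  go zero x enough | inj₂ (y , x<y) =
    contradiction (<-≤-trans x<y (≤-trans (value≤bound y) (subst (bound ≤_) (+-identityʳ _) enough))) (<-irrefl refl)
  go (suc fuel) x enough | inj₂ (y , x<y) =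
    go fuel y (≤-trans enough (subst (_≤ value y + fuel) (sym (+-suc (value x) fuel)) (+-monoˡ-≤ fuel x<y)))

-- Double counting in an incidence matrix.

module Incidence {m n : ℕ} (E : Fin m → Fin n → Bool) where

  -- Sizes may differ between edges, because deleting a vertex shrinks only the edges through it.
  -- The counting works with a lower bound on them.
  size : Fin m → ℕ
  size e = sum λ v → ⟦ E e v ⟧

  deg : Fin n → ℕ
  deg v = sum λ e → ⟦ E e v ⟧

  hits : Partition n r → Fin m → Fin r → ℕ
  hits p e i = sum λ v → ⟦ E e v ⟧ * δ (p v) i

  meet avoid clash : Partition n r → Fin r → ℕ
  meet  p i = sum λ e → isPos  (hits p e i)
  avoid p i = sum λ e → isZero (hits p e i)
  clash p i = sum λ e → isMany (hits p e i)

  gain : Partition n r → Fin r → Fin n → ℕ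
  gain p c v = sum λ e → ⟦ E e v ⟧ * isZero (hits p e c)

  -- If `e` contains `v` and has one vertex in the part of `v`, that vertex is `v`. So this counts
  -- the edges that the part stops meeting when `v` leaves.
  loss : Partition n r → Fin n → ℕ
  loss p v = sum λ e → ⟦ E e v ⟧ * isOne (hits p e (p v))

  -- For part `i` these are the x and y of the opening argument: the first counts incidences, the
  -- second edges.
  inside doubled : Partition n r → Fin r → Fin r → ℕ
  inside  p c i = sum λ e → isZero (hits p e c) * hits p e i
  doubled p c i = sum λ e → isZero (hits p e c) * isMany (hits p e i)

  partSize : Partition n r → Fin r → ℕ
  partSize p i = sum λ v → δ (p v) i

  move : Partition n r → Fin n → Fin r → Partition n r
  move p v c = updateAt p v (const c)

  meet+avoid : (p : Partition n r) (i : Fin r) → meet p i + avoid p i ≡ m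
  meet+avoid p i = begin
    meet p i + avoid p i                                   ≡⟨ ∑-distrib-+ (λ e → isPos (hits p e i)) (λ e → isZero (hits p e i)) ⟨
    sum (λ e → isPos (hits p e i) + isZero (hits p e i))   ≡⟨ sum-cong-≗ (λ e → isPos+isZero (hits p e i)) ⟩
    sum {m} (const 1)                                      ≡⟨ sum-one m ⟩
    m                                                      ∎
    where
    open ≡-Reasoning
    sum-one : ∀ n → sum {n} (const 1) ≡ n
    sum-one zero    = refl
    sum-one (suc n) = cong suc (sum-one n)

  ∑-hits : (p : Partition n r) (e : Fin m) → sum (hits p e) ≡ size e
  ∑-hits p e = begin
    sum (λ i → sum λ v → ⟦ E e v ⟧ * δ (p v) i)  ≡⟨ ∑-comm (λ i v → ⟦ E e v ⟧ * δ (p v) i) ⟩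
    sum (λ v → sum λ i → ⟦ E e v ⟧ * δ (p v) i)  ≡⟨ sum-cong-≗ (λ v → sym (*-distribˡ-sum ⟦ E e v ⟧ (δ (p v)))) ⟩
    sum (λ v → ⟦ E e v ⟧ * sum (δ (p v)))        ≡⟨ sum-cong-≗ (λ v → trans (cong (⟦ E e v ⟧ *_) (sum-δ (p v))) (*-identityʳ _)) ⟩
    size e                                       ∎
    where open ≡-Reasoning

  -- Weighted double counting: the sums over vertices and over edges are interchanged.
  ∑-part : (p : Partition n r) (i : Fin r) (w : Fin m → ℕ) →
           sum (λ v → sum (λ e → ⟦ E e v ⟧ * w e) * δ (p v) i) ≡ sum (λ e → w e * hits p e i)
  ∑-part p i w = begin
    sum (λ v → sum (λ e → ⟦ E e v ⟧ * w e) * δ (p v) i)    ≡⟨ sum-cong-≗ (λ v → *-distribʳ-sum (δ (p v) i) (λ e → ⟦ E e v ⟧ * w e)) ⟩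
    sum (λ v → sum λ e → ⟦ E e v ⟧ * w e * δ (p v) i)      ≡⟨ ∑-comm (λ v e → ⟦ E e v ⟧ * w e * δ (p v) i) ⟩
    sum (λ e → sum λ v → ⟦ E e v ⟧ * w e * δ (p v) i)      ≡⟨ sum-cong-≗ (λ e → sum-cong-≗ λ v → rotate ⟦ E e v ⟧ (w e) (δ (p v) i)) ⟩
    sum (λ e → sum λ v → w e * (⟦ E e v ⟧ * δ (p v) i))    ≡⟨ sum-cong-≗ (λ e → sym (*-distribˡ-sum (w e) (λ v → ⟦ E e v ⟧ * δ (p v) i))) ⟩
    sum (λ e → w e * hits p e i)                           ∎
    where
    open ≡-Reasoning
    rotate : ∀ a b c → a * b * c ≡ b * (a * c)
    rotate = solve-∀

  ∑-gain : (p : Partition n r) (c i : Fin r) → sum (λ v → gain p c v * δ (p v) i) ≡ inside p c i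
  ∑-gain p c i = ∑-part p i λ e → isZero (hits p e c)

  ∑-loss : (p : Partition n r) (i : Fin r) →
           sum (λ v → loss p v * δ (p v) i) ≡ sum (λ e → isOne (hits p e i) * hits p e i)
  ∑-loss p i = trans (sum-cong-≗ own) (∑-part p i λ e → isOne (hits p e i))
    where
    -- The edge weight in `loss` depends on the part of `v`. The factor `δ (p v) i` allows the
    -- weight for `i` to replace it, as `∑-part` requires.
    own : ∀ v → loss p v * δ (p v) i ≡ sum (λ e → ⟦ E e v ⟧ * isOne (hits p e i)) * δ (p v) i
    own v with p v ≟ i
    ... | yes refl = refl
    ... | no  _    = trans (*-zeroʳ (loss p v)) (sym (*-zeroʳ (sum λ e → ⟦ E e v ⟧ * isOne (hits p e i))))

  -- An edge met in one vertex is counted by the loss of that vertex, an edge met in several by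
  -- `clash`.
  ∑-loss+clash : (p : Partition n r) (i : Fin r) → sum (λ v → loss p v * δ (p v) i) + clash p i ≡ meet p i
  ∑-loss+clash p i = begin
    sum (λ v → loss p v * δ (p v) i) + clash p i                           ≡⟨ cong (_+ clash p i) (∑-loss p i) ⟩
    sum (λ e → isOne (hits p e i) * hits p e i) + clash p i                ≡⟨ ∑-distrib-+ (λ e → isOne (hits p e i) * hits p e i) (λ e → isMany (hits p e i)) ⟨
    sum (λ e → isOne (hits p e i) * hits p e i + isMany (hits p e i))      ≡⟨ sum-cong-≗ (λ e → isOne*-+isMany (hits p e i)) ⟩
    meet p i                                                               ∎
    where open ≡-Reasoning

  -- An edge with x vertices in the part adds x to the degree sum; on the left it adds 1 if x is 1
  -- and 2 if x is at least 2.
  ∑-loss+2*clash : (p : Partition n r) (i : Fin r) →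
                   sum (λ v → loss p v * δ (p v) i) + 2 * clash p i ≤ sum (λ v → deg v * δ (p v) i)
  ∑-loss+2*clash p i = begin
    sum (λ v → loss p v * δ (p v) i) + 2 * clash p i
      ≡⟨ cong₂ _+_ (∑-loss p i) (*-distribˡ-sum 2 (λ e → isMany (hits p e i))) ⟩
    sum (λ e → isOne (hits p e i) * hits p e i) + sum (λ e → 2 * isMany (hits p e i))
      ≡⟨ ∑-distrib-+ (λ e → isOne (hits p e i) * hits p e i) (λ e → 2 * isMany (hits p e i)) ⟨
    sum (λ e → isOne (hits p e i) * hits p e i + 2 * isMany (hits p e i))
      ≤⟨ sum-mono-≤ (λ e → isOne*-+2*isMany (hits p e i)) ⟩
    sum (λ e → hits p e i)
      ≡⟨ sum-cong-≗ (λ e → *-identityˡ (hits p e i)) ⟨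
    sum (λ e → 1 * hits p e i)
      ≡⟨ ∑-part p i (const 1) ⟨
    sum (λ v → sum (λ e → ⟦ E e v ⟧ * 1) * δ (p v) i)
      ≡⟨ sum-cong-≗ (λ v → cong (_* δ (p v) i) (sum-cong-≗ λ e → *-identityʳ ⟦ E e v ⟧)) ⟩
    sum (λ v → deg v * δ (p v) i)  ∎
    where open ≤-Reasoning

  doubled≤clash : (p : Partition n r) (c i : Fin r) → doubled p c i ≤ clash p i
  doubled≤clash p c i = sum-mono-≤ λ e →
    subst (isZero (hits p e c) * isMany (hits p e i) ≤_) (*-identityˡ _) (*-monoˡ-≤ (isMany (hits p e i)) (isZero-≤1 (hits p e c)))

  doubled≤inside : (p : Partition n r) (c i : Fin r) → doubled p c i ≤ inside p c i
  doubled≤inside p c i = sum-mono-≤ λ e → *-monoʳ-≤ (isZero (hits p e c)) (isMany-≤ (hits p e i))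

  inside-self : (p : Partition n r) (c : Fin r) → inside p c c ≡ 0
  inside-self p c = trans (sum-cong-≗ λ e → isZero*- (hits p e c)) (sum-replicate-zero m)

  doubled-self : (p : Partition n r) (c : Fin r) → doubled p c c ≡ 0
  doubled-self p c = trans (sum-cong-≗ λ e → isZero*isMany (hits p e c)) (sum-replicate-zero m)

  gain≤deg : (p : Partition n r) (c : Fin r) (v : Fin n) → gain p c v ≤ deg v
  gain≤deg p c v = sum-mono-≤ λ e →
    subst (⟦ E e v ⟧ * isZero (hits p e c) ≤_) (*-identityʳ _) (*-monoʳ-≤ ⟦ E e v ⟧ (isZero-≤1 (hits p e c)))

  -- An edge that avoids `c` has all its vertices, at least `suc k`, in the other parts.
  avoid≤∑-inside : (p : Partition n (suc k)) (c : Fin (suc k)) → (∀ e → suc k ≤ size e) →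
                   suc k * avoid p c ≤ sum (inside p c)
  avoid≤∑-inside {k} p c large = begin
    suc k * avoid p c                                        ≡⟨ *-distribˡ-sum (suc k) (λ e → isZero (hits p e c)) ⟩
    sum (λ e → suc k * isZero (hits p e c))                  ≤⟨ sum-mono-≤ (λ e → *-monoˡ-≤ (isZero (hits p e c)) (large e)) ⟩
    sum (λ e → size e * isZero (hits p e c))                 ≡⟨ sum-cong-≗ (λ e → trans (*-comm (size e) _) (cong (isZero (hits p e c) *_) (sym (∑-hits p e)))) ⟩
    sum (λ e → isZero (hits p e c) * sum (hits p e))         ≡⟨ sum-cong-≗ (λ e → *-distribˡ-sum (isZero (hits p e c)) (hits p e)) ⟩
    sum (λ e → sum λ i → isZero (hits p e c) * hits p e i)   ≡⟨ ∑-comm (λ e i → isZero (hits p e c) * hits p e i) ⟩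
    sum (inside p c)                                         ∎
    where open ≤-Reasoning

  -- By pigeonhole, an edge that avoids `c` has two vertices in one of the `k` other parts.
  avoid≤∑-doubled : (p : Partition n (suc k)) (c : Fin (suc k)) → (∀ e → suc k ≤ size e) →
                    avoid p c ≤ sum (doubled p c)
  avoid≤∑-doubled {k} p c large = begin
    avoid p c                                                        ≤⟨ sum-mono-≤ perEdge ⟩
    sum (λ e → isZero (hits p e c) * sum (λ i → isMany (hits p e i)))  ≡⟨ sum-cong-≗ (λ e → *-distribˡ-sum (isZero (hits p e c)) (λ i → isMany (hits p e i))) ⟩
    sum (λ e → sum λ i → isZero (hits p e c) * isMany (hits p e i))  ≡⟨ ∑-comm (λ e i → isZero (hits p e c) * isMany (hits p e i)) ⟩
    sum (doubled p c)                                                ∎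
    where
    open ≤-Reasoning
    perEdge : ∀ e → isZero (hits p e c) ≤ isZero (hits p e c) * sum (λ i → isMany (hits p e i))
    perEdge e with hits p e c in eq
    ... | suc _ = z≤n
    ... | zero  = ≤-trans (isMany-pigeonhole (hits p e) c eq (subst (suc k ≤_) (sym (∑-hits p e)) (large e)))
                          (≤-reflexive (sym (*-identityˡ _)))

  -- The effect of moving one vertex.

  hits-move : (p : Partition n r) (v : Fin n) (c : Fin r) (e : Fin m) (i : Fin r) →
              hits p e i + ⟦ E e v ⟧ * δ c i ≡ hits (move p v c) e i + ⟦ E e v ⟧ * δ (p v) i
  hits-move p v c e i = begin
    hits p e i + ⟦ E e v ⟧ * δ c i             ≡⟨ cong (λ j → hits p e i + ⟦ E e v ⟧ * δ j i) (updateAt-updates v p) ⟨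
    hits p e i + ⟦ E e v ⟧ * δ (move p v c v) i  ≡⟨ sum-update (λ u → ⟦ E e u ⟧ * δ (p u) i) (λ u → ⟦ E e u ⟧ * δ (move p v c u) i) v
                                                  (λ u u≢v → cong (λ j → ⟦ E e u ⟧ * δ j i) (sym (updateAt-minimal u v p u≢v))) ⟩
    hits (move p v c) e i + ⟦ E e v ⟧ * δ (p v) i  ∎
    where open ≡-Reasoning

  module _ (p : Partition n r) (v : Fin n) (c : Fin r) (pv≢c : p v ≢ c) where

    private
      *-δ-≡ : ∀ x {i j : Fin r} → i ≡ j → x * δ i j ≡ x
      *-δ-≡ x i≡j = trans (cong (x *_) (δ-≡ i≡j)) (*-identityʳ x)

      +-*-δ-≢ : ∀ y x {i j : Fin r} → i ≢ j → y + x * δ i j ≡ y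
      +-*-δ-≢ y x i≢j = trans (cong (λ d → y + x * d) (δ-≢ i≢j)) (trans (cong (y +_) (*-zeroʳ x)) (+-identityʳ y))

    hits-move-target : ∀ e → hits (move p v c) e c ≡ hits p e c + ⟦ E e v ⟧
    hits-move-target e = begin
      hits (move p v c) e c                          ≡⟨ +-*-δ-≢ _ ⟦ E e v ⟧ pv≢c ⟨
      hits (move p v c) e c + ⟦ E e v ⟧ * δ (p v) c  ≡⟨ hits-move p v c e c ⟨
      hits p e c + ⟦ E e v ⟧ * δ c c                 ≡⟨ cong (hits p e c +_) (*-δ-≡ ⟦ E e v ⟧ {c} refl) ⟩
      hits p e c + ⟦ E e v ⟧                         ∎
      where open ≡-Reasoning

    hits-move-source : ∀ e → hits p e (p v) ≡ hits (move p v c) e (p v) + ⟦ E e v ⟧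
    hits-move-source e = begin
      hits p e (p v)                                           ≡⟨ +-*-δ-≢ _ ⟦ E e v ⟧ (pv≢c ∘ sym) ⟨
      hits p e (p v) + ⟦ E e v ⟧ * δ c (p v)                   ≡⟨ hits-move p v c e (p v) ⟩
      hits (move p v c) e (p v) + ⟦ E e v ⟧ * δ (p v) (p v)    ≡⟨ cong (hits (move p v c) e (p v) +_) (*-δ-≡ ⟦ E e v ⟧ {p v} refl) ⟩
      hits (move p v c) e (p v) + ⟦ E e v ⟧                    ∎
      where open ≡-Reasoning

    hits-move-other : ∀ e i → i ≢ c → i ≢ p v → hits (move p v c) e i ≡ hits p e i
    hits-move-other e i i≢c i≢pv = begin
      hits (move p v c) e i                          ≡⟨ +-*-δ-≢ _ ⟦ E e v ⟧ (i≢pv ∘ sym) ⟨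
      hits (move p v c) e i + ⟦ E e v ⟧ * δ (p v) i  ≡⟨ hits-move p v c e i ⟨
      hits p e i + ⟦ E e v ⟧ * δ c i                 ≡⟨ +-*-δ-≢ _ ⟦ E e v ⟧ (i≢c ∘ sym) ⟩
      hits p e i                                     ∎
      where open ≡-Reasoning

    hits-move-anti : ∀ e i → i ≢ c → hits (move p v c) e i ≤ hits p e i
    hits-move-anti e i i≢c with i ≟ p v
    ... | yes refl = ≤-trans (m≤m+n _ _) (≤-reflexive (sym (hits-move-source e)))
    ... | no  i≢pv = ≤-reflexive (hits-move-other e i i≢c i≢pv)

    meet-move-target : meet (move p v c) c ≡ meet p c + gain p c v
    meet-move-target = trans
      (sum-cong-≗ λ e → trans (cong isPos (hits-move-target e)) (isPos-+ (hits p e c) (E e v)))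
      (∑-distrib-+ (λ e → isPos (hits p e c)) (λ e → ⟦ E e v ⟧ * isZero (hits p e c)))

    meet-move-source : meet p (p v) ≡ meet (move p v c) (p v) + loss p v
    meet-move-source = trans (sum-cong-≗ perEdge)
      (∑-distrib-+ (λ e → isPos (hits (move p v c) e (p v))) (λ e → ⟦ E e v ⟧ * isOne (hits p e (p v))))
      where
      perEdge : ∀ e → isPos (hits p e (p v)) ≡ isPos (hits (move p v c) e (p v)) + ⟦ E e v ⟧ * isOne (hits p e (p v))
      perEdge e rewrite hits-move-source e = isPos-+-isOne (hits (move p v c) e (p v)) (E e v)

    meet-move-other : ∀ i → i ≢ c → i ≢ p v → meet (move p v c) i ≡ meet p i
    meet-move-other i i≢c i≢pv = sum-cong-≗ λ e → cong isPos (hits-move-other e i i≢c i≢pv)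

    -- Part `c` has grown, so fewer edges avoid it.
    gain-move : ∀ u → gain (move p v c) c u ≤ gain p c u
    gain-move u = sum-mono-≤ λ e → *-monoʳ-≤ ⟦ E e u ⟧
      (isZero-anti (≤-trans (m≤m+n _ _) (≤-reflexive (sym (hits-move-target e)))))

    -- The other parts can only shrink, so a sole vertex of an edge in its part remains the sole
    -- one.
    loss-move : ∀ u → move p v c u ≢ c → loss p u ≤ loss (move p v c) u
    loss-move u p′u≢c = sum-mono-≤ perEdge
      where
      p′ = move p v c
      p′u≡pu : p′ u ≡ p u
      p′u≡pu with u ≟ v
      ... | yes refl = contradiction (updateAt-updates v p) p′u≢c
      ... | no  u≢v  = updateAt-minimal u v p u≢v
      perEdge : ∀ e → ⟦ E e u ⟧ * isOne (hits p e (p u)) ≤ ⟦ E e u ⟧ * isOne (hits p′ e (p′ u))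
      perEdge e with E e u in eq
      ... | false = z≤n
      ... | true  = *-monoʳ-≤ 1 (isOne-anti touched (≤-trans (hits-move-anti e (p′ u) p′u≢c) (≤-reflexive (cong (hits p e) p′u≡pu))))
        where
        -- The vertex `u` of `e` is still in its part, so the count has not dropped to 0, where
        -- `isOne` would vanish.
        touched : 1 ≤ hits p′ e (p′ u)
        touched = ≤-trans
          (≤-reflexive (sym (trans (cong (λ b → ⟦ b ⟧ * δ (p′ u) (p′ u)) eq) (*-δ-≡ 1 {p′ u} refl))))
          (term-≤-sum (λ w → ⟦ E e w ⟧ * δ (p′ w) (p′ u)) u)

-- Arithmetic of the cap.

-- Here `α` is the gain, `β` the loss, `y` what the source part keeps, and `b` the cap. If `b ≤ y`,
-- the source part stays at the cap and `α` must be 0. Otherwise `y` cancels, and what `y + β` has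
-- beyond `b` is worth nothing.
capped-gain : ∀ α β y b → α + (y ⊓ b) ≤ (y + β) ⊓ b → α ≤ β ∸ ((y + β) ∸ b)
capped-gain α β y b α+y⊓b≤ with ≤-total y b
... | inj₂ b≤y = ≤-trans (≤-reflexive α≡0) z≤n
  where
  α+b≤b : α + b ≤ b
  α+b≤b = subst (λ z → α + z ≤ b) (m≥n⇒m⊓n≡n b≤y) (≤-trans α+y⊓b≤ (m⊓n≤n (y + β) b))
  α≡0 : α ≡ 0
  α≡0 = n≤0⇒n≡0 (+-cancelʳ-≤ b α 0 α+b≤b)
... | inj₁ y≤b with subst (λ z → α + z ≤ (y + β) ⊓ b) (m≤n⇒m⊓n≡m y≤b) α+y⊓b≤
...   | α+y≤ with ≤-total (y + β) b
...     | inj₁ y+β≤b rewrite m≤n⇒m∸n≡0 y+β≤b =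
  +-cancelˡ-≤ y α β (subst (_≤ y + β) (+-comm α y) (≤-trans α+y≤ (m⊓n≤m (y + β) b)))
...     | inj₂ b≤y+β = m+n≤o⇒m≤o∸n α (+-cancelˡ-≤ y (α + o) β (begin
  y + (α + o)  ≡⟨ rotate y α o ⟩
  α + y + o    ≤⟨ +-monoˡ-≤ o (≤-trans α+y≤ (m⊓n≤n (y + β) b)) ⟩
  b + o        ≡⟨ m+[n∸m]≡n b≤y+β ⟩
  y + β        ∎))
  where
  open ≤-Reasoning
  o = (y + β) ∸ b
  rotate : ∀ x y z → x + (y + z) ≡ y + x + z
  rotate = solve-∀

-- If `f ≤ b`, then `a + d ≤ l + c` suffices. Otherwise the excess of `f` over `b` has been taken
-- off `a`; when it exhausts `l`, the bound `d ≤ a` makes `d` vanish with `a`.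
capped-total : ∀ {a d l c f b} → a ≤ l ∸ (f ∸ b) → d ≤ c → d ≤ a → l + c ≡ f → a + d ≤ b
capped-total {a} {d} {l} {c} {f} {b} a≤ d≤c d≤a l+c≡f with ≤-total f b | ≤-total l (f ∸ b)
... | inj₁ f≤b | _ = ≤-trans (+-mono-≤ (≤-trans a≤ (m∸n≤m l (f ∸ b))) d≤c) (≤-trans (≤-reflexive l+c≡f) f≤b)
... | inj₂ b≤f | inj₁ l≤o = ≤-trans (+-mono-≤ a≤0 (≤-trans d≤a a≤0)) z≤n
  where
  a≤0 : a ≤ 0
  a≤0 = subst (a ≤_) (m≤n⇒m∸n≡0 l≤o) a≤
... | inj₂ b≤f | inj₂ o≤l = +-cancelʳ-≤ (f ∸ b) (a + d) b (begin
  a + d + (f ∸ b)    ≡⟨ rotate a d (f ∸ b) ⟩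
  a + (f ∸ b) + d    ≤⟨ +-mono-≤ (≤-trans (+-monoˡ-≤ (f ∸ b) a≤) (≤-reflexive (m∸n+n≡m o≤l))) d≤c ⟩
  l + c              ≡⟨ l+c≡f ⟩
  f                  ≡⟨ m+[n∸m]≡n b≤f ⟨
  b + (f ∸ b)        ∎)
  where
  open ≤-Reasoning
  rotate : ∀ x y z → x + y + z ≡ x + z + y
  rotate = solve-∀

-- With f = t + ε the hypotheses read s ε + c ≤ t + ε and ε ≥ 0, and s ≥ 3 gives f + c ≤ 2t.
three-critical : ∀ {s t f l c} → 3 ≤ s → t ≤ f → l + c ≡ f → s * f ≤ s * t + l → f + c ≤ 2 * t
three-critical {s} {t} {f} {l} {c} 3≤s t≤f l+c≡f crit with m≤n⇒∃[o]m+o≡n t≤f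
... | ε , refl = +-cancelʳ-≤ (2 * ε) (t + ε + c) (2 * t) (begin
  t + ε + c + 2 * ε      ≡⟨ regroup t ε c ⟩
  t + (3 * ε + c)        ≤⟨ +-monoʳ-≤ t (+-monoˡ-≤ c (≤-trans (*-monoˡ-≤ ε 3≤s) sε≤l)) ⟩
  t + (l + c)            ≡⟨ cong (t +_) l+c≡f ⟩
  t + (t + ε)            ≤⟨ +-monoʳ-≤ t (+-monoʳ-≤ t (m≤m+n ε (ε + 0))) ⟩
  t + (t + 2 * ε)        ≡⟨ regroup′ t ε ⟩
  2 * t + 2 * ε          ∎)
  where
  open ≤-Reasoning
  regroup : ∀ t ε c → t + ε + c + 2 * ε ≡ t + (3 * ε + c)
  regroup = solve-∀
  regroup′ : ∀ t ε → t + (t + 2 * ε) ≡ 2 * t + 2 * ε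
  regroup′ = solve-∀
  sε≤l : s * ε ≤ l
  sε≤l = +-cancelˡ-≤ (s * t) (s * ε) l (subst (_≤ s * t + l) (*-distribˡ-+ s t ε) crit)

-- Balancing when all degrees are below the threshold.

module Balance {k m n : ℕ} (E : Fin m → Fin n → Bool) (num den : ℕ) where

  open Incidence E

  -- The ratio c is `num / den`, and all edge counts are multiplied by `den`, so this is t scaled by
  -- `den`. The ratio is independent of `k` because it stays fixed while the induction lowers `k`.
  threshold : ℕ
  threshold = num * m

  Good : Partition n (suc k) → Fin (suc k) → Set
  Good p i = threshold ≤ den * meet p i

  -- The cap 2 · threshold is never reached by a bad part that receives one vertex of degree
  -- below the threshold, so at a local maximum a move into a bad part gains no more than it loses.
  value : Partition n (suc k) → ℕ
  value p = sum λ i → (den * meet p i) ⊓ (2 * threshold)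

  LocallyMaximal : Partition n (suc k) → Set
  LocallyMaximal p = ∀ v i → value (move p v i) ≤ value p

  locallyMaximal : ∃ LocallyMaximal
  locallyMaximal = ascend value (suc k * (2 * threshold))
    (λ p → sum-≤-* λ i → m⊓n≤n (den * meet p i) (2 * threshold)) step (const zero)
    where
    step : ∀ p → LocallyMaximal p ⊎ ∃ λ p′ → value p < value p′
    step p with any? (λ v → any? λ i → value p <? value (move p v i))
    ... | yes (v , i , better) = inj₂ (move p v i , better)
    ... | no  none             = inj₁ λ v i → ≮⇒≥ λ better → none (v , i , better)

  -- In terms of r = k + 1 the ratio is at most (r + 1) / (3r - 2) and at most (r + 2) / (3r). The
  -- first bound excludes a second bad part, the second makes the last part good.
  module _ (large : ∀ e → suc k ≤ size e) (light : ∀ v → den * deg v < threshold)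
           (ratio₁ : (3 * k + 1) * num ≤ (2 + k) * den) (ratio₂ : (3 * k + 3) * num ≤ (3 + k) * den) where

    -- Every edge either meets or avoids `c`, so if `c` is bad, a ratio bound forces many edges to
    -- avoid it.
    threshold-split : (p : Partition n (suc k)) (c : Fin (suc k)) (x y : ℕ) → x * num ≤ y * den →
                      x * threshold ≤ y * (den * avoid p c) + y * (den * meet p c)
    threshold-split p c x y x≤y = begin
      x * (num * m)                                    ≡⟨ *-assoc x num m ⟨
      x * num * m                                      ≤⟨ *-monoˡ-≤ m x≤y ⟩
      y * den * m                                      ≡⟨ cong (y * den *_) (meet+avoid p c) ⟨
      y * den * (meet p c + avoid p c)                 ≡⟨ expand y den (meet p c) (avoid p c) ⟩
      y * (den * avoid p c) + y * (den * meet p c)     ∎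
      where
      open ≤-Reasoning
      expand : ∀ y d a b → y * d * (a + b) ≡ y * (d * b) + y * (d * a)
      expand = solve-∀

    scale-∑ : (f : Fin n → ℕ) → den * sum f ≡ sum (λ v → den * f v)
    scale-∑ = *-distribˡ-sum den

    scaled-loss+clash : (p : Partition n (suc k)) (i : Fin (suc k)) →
                        den * sum (λ v → loss p v * δ (p v) i) + den * clash p i ≡ den * meet p i
    scaled-loss+clash p i = trans (sym (*-distribˡ-+ den (sum λ v → loss p v * δ (p v) i) (clash p i)))
                                  (cong (den *_) (∑-loss+clash p i))

    -- First phase: a local maximum has at most one bad part.

    module FirstPhase (p : Partition n (suc k)) (maximal : LocallyMaximal p)
                      (c : Fin (suc k)) (bad : den * meet p c < threshold) where

      -- Edges of the source part beyond the cap do not count in `value`. Giving them up is free, so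
      -- only the rest of the loss bounds the gain.
      capped : ∀ v → p v ≢ c → den * gain p c v ≤ den * loss p v ∸ (den * meet p (p v) ∸ 2 * threshold)
      capped v pv≢c = subst (λ f → den * gain p c v ≤ den * loss p v ∸ (f ∸ b)) (sym source)
        (capped-gain (den * gain p c v) (den * loss p v) (den * meet p′ (p v)) b (+-cancelˡ-≤ (den * meet p c) _ _ (begin
          den * meet p c + (den * gain p c v + g′ (p v))  ≡⟨ +-assoc (den * meet p c) _ _ ⟨
          den * meet p c + den * gain p c v + g′ (p v)    ≡⟨ cong (_+ g′ (p v)) target ⟨
          g′ c + g′ (p v)                                 ≤⟨ +-cancelˡ-≤ (value p) _ _ exchange ⟩
          g c + g (p v)                                   ≤⟨ +-monoˡ-≤ (g (p v)) (m⊓n≤m (den * meet p c) b) ⟩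
          den * meet p c + g (p v)                        ≡⟨ cong (λ f → den * meet p c + f ⊓ b) source ⟩
          den * meet p c + (den * meet p′ (p v) + den * loss p v) ⊓ b  ∎)))
        where
        open ≤-Reasoning
        b = 2 * threshold
        p′ = move p v c
        g g′ : Fin (suc k) → ℕ
        g  i = (den * meet p i) ⊓ b
        g′ i = (den * meet p′ i) ⊓ b
        source : den * meet p (p v) ≡ den * meet p′ (p v) + den * loss p v
        source = trans (cong (den *_) (meet-move-source p v c pv≢c)) (*-distribˡ-+ den (meet p′ (p v)) (loss p v))
        below : den * meet p c + den * gain p c v ≤ b
        below = +-mono-≤ (<⇒≤ bad) (≤-trans (*-monoʳ-≤ den (gain≤deg p c v))
                                            (≤-trans (<⇒≤ (light v)) (m≤m+n threshold 0)))
        target : g′ c ≡ den * meet p c + den * gain p c v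
        target = trans (cong (_⊓ b) (trans (cong (den *_) (meet-move-target p v c pv≢c)) (*-distribˡ-+ den (meet p c) (gain p c v))))
                       (m≤n⇒m⊓n≡m below)
        -- Only the terms of `c` and `p v` change, so comparing the two values amounts to comparing
        -- these terms.
        exchange : value p + (g′ c + g′ (p v)) ≤ value p + (g c + g (p v))
        exchange = begin
          value p + (g′ c + g′ (p v))   ≡⟨ sum-update₂ g g′ c (p v) (pv≢c ∘ sym) (λ i i≢c i≢pv →
                                             cong (λ f → (den * f) ⊓ b) (sym (meet-move-other p v c pv≢c i i≢c i≢pv))) ⟩
          value p′ + (g c + g (p v))    ≤⟨ +-monoˡ-≤ (g c + g (p v)) (maximal v c) ⟩
          value p + (g c + g (p v))     ∎

      scaled-gain≤loss : ∀ v → p v ≢ c → den * gain p c v ≤ den * loss p v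
      scaled-gain≤loss v pv≢c = ≤-trans (capped v pv≢c) (m∸n≤m (den * loss p v) (den * meet p (p v) ∸ 2 * threshold))

      scaled-inside : ∀ i → i ≢ c → den * inside p c i ≤
                      den * sum (λ v → loss p v * δ (p v) i) ∸ (den * meet p i ∸ 2 * threshold)
      scaled-inside i i≢c = begin
        den * inside p c i                                 ≡⟨ cong (den *_) (∑-gain p c i) ⟨
        den * sum (λ v → gain p c v * δ (p v) i)           ≡⟨ scale-∑ (λ v → gain p c v * δ (p v) i) ⟩
        sum (λ v → den * (gain p c v * δ (p v) i))         ≤⟨ sum-mono-≤ perVertex ⟩
        sum (λ v → den * (loss p v * δ (p v) i) ∸ o)       ≤⟨ sum-∸-≤ (λ v → den * (loss p v * δ (p v) i)) o ⟩
        sum (λ v → den * (loss p v * δ (p v) i)) ∸ o       ≡⟨ cong (_∸ o) (scale-∑ (λ v → loss p v * δ (p v) i)) ⟨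
        den * sum (λ v → loss p v * δ (p v) i) ∸ o         ∎
        where
        open ≤-Reasoning
        o = den * meet p i ∸ 2 * threshold
        perVertex : ∀ v → den * (gain p c v * δ (p v) i) ≤ den * (loss p v * δ (p v) i) ∸ o
        perVertex v with p v ≟ i
        ... | yes refl rewrite *-identityʳ (gain p c v) | *-identityʳ (loss p v) = capped v i≢c
        ... | no  _ = ≤-trans (≤-reflexive (trans (cong (den *_) (*-zeroʳ (gain p c v))) (*-zeroʳ den))) z≤n

      weight : Fin (suc k) → ℕ
      weight i = den * inside p c i + den * doubled p c i

      weight≤2*threshold : ∀ i → i ≢ c → weight i ≤ 2 * threshold
      weight≤2*threshold i i≢c = capped-total (scaled-inside i i≢c) (*-monoʳ-≤ den (doubled≤clash p c i))
        (*-monoʳ-≤ den (doubled≤inside p c i)) (scaled-loss+clash p i)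

      -- For a second bad part this gives less than one threshold, where the general bound allows
      -- two.
      weight≤meet : ∀ i → i ≢ c → weight i ≤ den * meet p i
      weight≤meet i i≢c = ≤-trans
        (+-mono-≤ (≤-trans (scaled-inside i i≢c) (m∸n≤m (den * sum λ v → loss p v * δ (p v) i) (den * meet p i ∸ 2 * threshold))) (*-monoʳ-≤ den (doubled≤clash p c i)))
        (≤-reflexive (scaled-loss+clash p i))

      -- An edge that avoids `c` is counted at least k + 1 times in `inside` and at least once in
      -- `doubled`.
      ∑-weight : (2 + k) * (den * avoid p c) ≤ sum weight
      ∑-weight = begin
        (2 + k) * (den * avoid p c)                                ≡⟨ split k den (avoid p c) ⟩
        den * (suc k * avoid p c) + den * avoid p c                ≤⟨ +-mono-≤ (*-monoʳ-≤ den (avoid≤∑-inside p c large)) (*-monoʳ-≤ den (avoid≤∑-doubled p c large)) ⟩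
        den * sum (inside p c) + den * sum (doubled p c)           ≡⟨ cong₂ _+_ (*-distribˡ-sum den (inside p c)) (*-distribˡ-sum den (doubled p c)) ⟩
        sum (λ i → den * inside p c i) + sum (λ i → den * doubled p c i)  ≡⟨ ∑-distrib-+ (λ i → den * inside p c i) (λ i → den * doubled p c i) ⟨
        sum weight                                                 ∎
        where
        open ≤-Reasoning
        split : ∀ k d a → (2 + k) * (d * a) ≡ d * (suc k * a) + d * a
        split = solve-∀

      -- With a second bad part the weights sum to at most (2k - 1) t. Adding (2 + k) times the
      -- edges at `c`, which is less than (2 + k) t, gives less than (3k + 1) t, against `ratio₁`.
      others-good : ∀ i → i ≢ c → Good p i
      others-good j j≢c = ≮⇒≥ λ bad′ → <-irrefl refl (begin-strict
        (3 * k + 1) * threshold + threshold                                           ≤⟨ +-monoˡ-≤ threshold (threshold-split p c (3 * k + 1) (2 + k) ratio₁) ⟩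
        (2 + k) * (den * avoid p c) + (2 + k) * (den * meet p c) + threshold          ≡⟨ rotate ((2 + k) * (den * avoid p c)) ((2 + k) * (den * meet p c)) threshold ⟩
        ((2 + k) * (den * avoid p c) + threshold) + (2 + k) * (den * meet p c)        ≤⟨ +-monoˡ-≤ ((2 + k) * (den * meet p c)) (≤-trans (+-monoˡ-≤ threshold ∑-weight) (bound bad′)) ⟩
        k * (2 * threshold) + (2 + k) * (den * meet p c)                              <⟨ +-monoʳ-< (k * (2 * threshold)) (*-monoʳ-< (2 + k) bad) ⟩
        k * (2 * threshold) + (2 + k) * threshold                                     ≡⟨ collect k threshold ⟩
        (3 * k + 1) * threshold + threshold                                           ∎)
        where
        open ≤-Reasoning
        rotate : ∀ x y z → x + y + z ≡ x + z + y
        rotate = solve-∀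
        collect : ∀ k t → k * (2 * t) + (2 + k) * t ≡ (3 * k + 1) * t + t
        collect = solve-∀
        -- An extra `threshold` placed at `j` still leaves that part within twice the threshold, so
        -- one uniform bound serves all parts other than `c`.
        bound : den * meet p j < threshold → sum weight + threshold ≤ k * (2 * threshold)
        bound bad′ = begin
          sum weight + threshold                          ≡⟨ cong (sum weight +_) (sym total) ⟩
          sum weight + sum (λ i → threshold * δ j i)      ≡⟨ ∑-distrib-+ weight (λ i → threshold * δ j i) ⟨
          sum (λ i → weight i + threshold * δ j i)        ≤⟨ sum-skip (λ i → weight i + threshold * δ j i) c at-c elsewhere ⟩
          k * (2 * threshold)                             ∎
          where
          total : sum (λ i → threshold * δ j i) ≡ threshold
          total = trans (sym (*-distribˡ-sum threshold (δ j))) (trans (cong (threshold *_) (sum-δ j)) (*-identityʳ threshold))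
          at-c : weight c + threshold * δ j c ≡ 0
          at-c rewrite inside-self p c | doubled-self p c | δ-≢ j≢c | *-zeroʳ den | *-zeroʳ threshold = refl
          elsewhere : ∀ i → i ≢ c → weight i + threshold * δ j i ≤ 2 * threshold
          elsewhere i i≢c with j ≟ i
          ... | no  _    rewrite *-zeroʳ threshold | +-identityʳ (weight i) = weight≤2*threshold i i≢c
          ... | yes refl = +-mono-≤ (≤-trans (weight≤meet j i≢c) (<⇒≤ bad′))
                                    (≤-reflexive (trans (*-identityʳ threshold) (sym (+-identityʳ threshold))))

    -- Trimming the other parts.

    -- The invariant of trimming. Moves into `c` may destroy local maximality, but its consequence
    -- that gains are at most losses survives them.
    record Trimmable (c : Fin (suc k)) : Set where
      constructor trimmable
      field
        part        : Partition n (suc k)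
        others-good : ∀ i → i ≢ c → Good part i
        gain≤loss   : ∀ v → part v ≢ c → den * gain part c v ≤ den * loss part v

    open Trimmable

    Critical : ∀ {c} → Trimmable c → Set
    Critical {c} s = ∀ v → part s v ≢ c → den * meet (move (part s) v c) (part s v) < threshold

    -- Each move enlarges part `c`, which has at most `n` vertices, so the process ends.
    trim : ∀ {c} → Trimmable c → ∃ λ (s : Trimmable c) → Critical s
    trim {c} = ascend (λ s → partSize (part s) c) (n * 1) (λ s → sum-≤-* λ v → ⟦⟧≤1 (does (part s v ≟ c))) step
      where
      step : ∀ s → Critical s ⊎ ∃ λ s′ → partSize (part s) c < partSize (part s′) c
      step s with any? (λ v → ¬? (part s v ≟ c) ×-dec (threshold ≤? den * meet (move (part s) v c) (part s v)))
      ... | no  none = inj₁ λ v pv≢c → ≰⇒> λ good → none (v , pv≢c , good)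
      ... | yes (v , pv≢c , good) = inj₂ (s′ , larger)
        where
        p  = part s
        p′ = move p v c
        good′ : ∀ i → i ≢ c → Good p′ i
        good′ i i≢c with i ≟ p v
        ... | yes refl = good
        ... | no  i≢pv = subst (λ f → threshold ≤ den * f) (sym (meet-move-other p v c pv≢c i i≢c i≢pv)) (others-good s i i≢c)
        gain≤loss′ : ∀ u → p′ u ≢ c → den * gain p′ c u ≤ den * loss p′ u
        gain≤loss′ u p′u≢c = ≤-trans (*-monoʳ-≤ den (gain-move p v c pv≢c u))
          (≤-trans (gain≤loss s u pu≢c) (*-monoʳ-≤ den (loss-move p v c pv≢c u p′u≢c)))
          where
          pu≢c : p u ≢ c
          pu≢c with u ≟ v
          ... | yes refl = pv≢c
          ... | no  u≢v  = p′u≢c ∘ trans (updateAt-minimal u v p u≢v)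
        s′ = trimmable p′ good′ gain≤loss′
        larger : partSize p c < partSize p′ c
        larger = ≤-reflexive (begin
          suc (partSize p c)              ≡⟨ +-comm 1 (partSize p c) ⟩
          partSize p c + 1                ≡⟨ cong (partSize p c +_) (δ-≡ (updateAt-updates v p)) ⟨
          partSize p c + δ (p′ v) c       ≡⟨ sum-update (λ u → δ (p u) c) (λ u → δ (p′ u) c) v (λ u u≢v → cong (λ i → δ i c) (sym (updateAt-minimal u v p u≢v))) ⟩
          partSize p′ c + δ (p v) c       ≡⟨ cong (partSize p′ c +_) (δ-≢ pv≢c) ⟩
          partSize p′ c + 0               ≡⟨ +-identityʳ _ ⟩
          partSize p′ c                   ∎)
          where open ≡-Reasoning

    -- Second phase: the remaining part is good.

    module SecondPhase {c : Fin (suc k)} (s : Trimmable c) (critical : Critical s) where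

      private
        p = part s
        Λ : Fin (suc k) → ℕ
        Λ i = sum λ v → loss p v * δ (p v) i

      scaled-inside : ∀ i → i ≢ c → den * inside p c i ≤ den * Λ i
      scaled-inside i i≢c = begin
        den * inside p c i                            ≡⟨ cong (den *_) (∑-gain p c i) ⟨
        den * sum (λ v → gain p c v * δ (p v) i)      ≡⟨ scale-∑ (λ v → gain p c v * δ (p v) i) ⟩
        sum (λ v → den * (gain p c v * δ (p v) i))    ≤⟨ sum-mono-≤ perVertex ⟩
        sum (λ v → den * (loss p v * δ (p v) i))      ≡⟨ scale-∑ (λ v → loss p v * δ (p v) i) ⟨
        den * Λ i                                     ∎
        where
        open ≤-Reasoning
        perVertex : ∀ v → den * (gain p c v * δ (p v) i) ≤ den * (loss p v * δ (p v) i)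
        perVertex v with p v ≟ i
        ... | yes refl rewrite *-identityʳ (gain p c v) | *-identityʳ (loss p v) = gain≤loss s v i≢c
        ... | no  _ = ≤-reflexive (cong (den *_) (trans (*-zeroʳ (gain p c v)) (sym (*-zeroʳ (loss p v)))))

      -- At most two vertices, each of degree below the threshold, have degree sum at most twice the
      -- threshold.
      few : ∀ i → partSize p i ≤ 2 → den * Λ i + 2 * (den * clash p i) ≤ 2 * threshold
      few i small = begin
        den * Λ i + 2 * (den * clash p i)             ≡⟨ factor den (Λ i) (clash p i) ⟩
        den * (Λ i + 2 * clash p i)                   ≤⟨ *-monoʳ-≤ den (∑-loss+2*clash p i) ⟩
        den * sum (λ v → deg v * δ (p v) i)           ≡⟨ scale-∑ (λ v → deg v * δ (p v) i) ⟩
        sum (λ v → den * (deg v * δ (p v) i))         ≡⟨ sum-cong-≗ (λ v → sym (*-assoc den (deg v) (δ (p v) i))) ⟩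
        sum (λ v → den * deg v * δ (p v) i)           ≤⟨ sum-mono-≤ (λ v → *-monoˡ-≤ (δ (p v) i) (<⇒≤ (light v))) ⟩
        sum (λ v → threshold * δ (p v) i)             ≡⟨ *-distribˡ-sum threshold (λ v → δ (p v) i) ⟨
        threshold * partSize p i                      ≤⟨ *-monoʳ-≤ threshold small ⟩
        threshold * 2                                 ≡⟨ *-comm threshold 2 ⟩
        2 * threshold                                 ∎
        where
        open ≤-Reasoning
        factor : ∀ d x y → d * x + 2 * (d * y) ≡ d * (x + 2 * y)
        factor = solve-∀

      -- Removing any single vertex of the part leaves fewer edges than the threshold. These
      -- inequalities are added over its vertices.
      ∑-critical : ∀ i → i ≢ c → partSize p i * (den * meet p i) ≤ partSize p i * threshold + den * Λ i
      ∑-critical i i≢c = begin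
        partSize p i * (den * meet p i)                                        ≡⟨ *-distribʳ-sum (den * meet p i) (λ v → δ (p v) i) ⟩
        sum (λ v → δ (p v) i * (den * meet p i))                               ≤⟨ sum-mono-≤ perVertex ⟩
        sum (λ v → δ (p v) i * threshold + den * (loss p v * δ (p v) i))       ≡⟨ ∑-distrib-+ (λ v → δ (p v) i * threshold) (λ v → den * (loss p v * δ (p v) i)) ⟩
        sum (λ v → δ (p v) i * threshold) + sum (λ v → den * (loss p v * δ (p v) i))
          ≡⟨ cong₂ _+_ (*-distribʳ-sum threshold (λ v → δ (p v) i)) (scale-∑ (λ v → loss p v * δ (p v) i)) ⟨
        partSize p i * threshold + den * Λ i                                   ∎
        where
        open ≤-Reasoning
        perVertex : ∀ v → δ (p v) i * (den * meet p i) ≤ δ (p v) i * threshold + den * (loss p v * δ (p v) i)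
        perVertex v with p v ≟ i
        ... | no  _ = z≤n
        ... | yes refl rewrite *-identityʳ (loss p v) | +-identityʳ (den * meet p (p v)) | +-identityʳ threshold = begin
          den * meet p (p v)                                       ≡⟨ cong (den *_) (meet-move-source p v c i≢c) ⟩
          den * (meet (move p v c) (p v) + loss p v)               ≡⟨ *-distribˡ-+ den (meet (move p v c) (p v)) (loss p v) ⟩
          den * meet (move p v c) (p v) + den * loss p v           ≤⟨ +-monoˡ-≤ (den * loss p v) (<⇒≤ (critical v i≢c)) ⟩
          threshold + den * loss p v                               ∎

      weight : Fin (suc k) → ℕ
      weight i = den * inside p c i + 2 * (den * doubled p c i)

      weight≤2*threshold : ∀ i → i ≢ c → weight i ≤ 2 * threshold
      weight≤2*threshold i i≢c = ≤-trans
        (+-mono-≤ (scaled-inside i i≢c) (*-monoʳ-≤ 2 (*-monoʳ-≤ den (doubled≤clash p c i)))) bound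
        where
        bound : den * Λ i + 2 * (den * clash p i) ≤ 2 * threshold
        bound with partSize p i ≤? 2
        ... | yes small = few i small
        -- Losses plus one `clash` make up `meet`, which leaves `meet` plus `clash` for
        -- `three-critical`.
        ... | no  many  = ≤-trans (≤-reflexive (trans (regroup (den * Λ i) (den * clash p i)) (cong (_+ den * clash p i) (scaled-loss+clash p i))))
          (three-critical (≰⇒> many) (others-good s i i≢c) (scaled-loss+clash p i) (∑-critical i i≢c))
          where
          regroup : ∀ x y → x + 2 * y ≡ (x + y) + y
          regroup = solve-∀

      -- As in the first phase, but `doubled` now counts twice, which turns 2 + k into 3 + k.
      ∑-weight : (3 + k) * (den * avoid p c) ≤ sum weight
      ∑-weight = begin
        (3 + k) * (den * avoid p c)                                        ≡⟨ split k den (avoid p c) ⟩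
        den * (suc k * avoid p c) + 2 * den * avoid p c                    ≤⟨ +-mono-≤ (*-monoʳ-≤ den (avoid≤∑-inside p c large)) (*-monoʳ-≤ (2 * den) (avoid≤∑-doubled p c large)) ⟩
        den * sum (inside p c) + 2 * den * sum (doubled p c)               ≡⟨ cong₂ _+_ (*-distribˡ-sum den (inside p c)) (*-distribˡ-sum (2 * den) (doubled p c)) ⟩
        sum (λ i → den * inside p c i) + sum (λ i → 2 * den * doubled p c i)  ≡⟨ ∑-distrib-+ (λ i → den * inside p c i) (λ i → 2 * den * doubled p c i) ⟨
        sum (λ i → den * inside p c i + 2 * den * doubled p c i)           ≡⟨ sum-cong-≗ (λ i → cong (den * inside p c i +_) (*-assoc 2 den (doubled p c i))) ⟩
        sum weight                                                         ∎
        where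
        open ≤-Reasoning
        split : ∀ k d a → (3 + k) * (d * a) ≡ d * (suc k * a) + 2 * d * a
        split = solve-∀

      -- If `c` were bad, the weights, at most 2kt, and (3 + k) times the edges at `c` would give
      -- less than (3k + 3) t, against `ratio₂`.
      target-good : Good p c
      target-good = ≮⇒≥ λ bad → <-irrefl refl (begin-strict
        (3 * k + 3) * threshold                                     ≤⟨ threshold-split p c (3 * k + 3) (3 + k) ratio₂ ⟩
        (3 + k) * (den * avoid p c) + (3 + k) * (den * meet p c)    ≤⟨ +-monoˡ-≤ ((3 + k) * (den * meet p c)) (≤-trans ∑-weight (sum-skip weight c at-c weight≤2*threshold)) ⟩
        k * (2 * threshold) + (3 + k) * (den * meet p c)            <⟨ +-monoʳ-< (k * (2 * threshold)) (*-monoʳ-< (3 + k) bad) ⟩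
        k * (2 * threshold) + (3 + k) * threshold                   ≡⟨ collect k threshold ⟩
        (3 * k + 3) * threshold                                     ∎)
        where
        open ≤-Reasoning
        collect : ∀ k t → k * (2 * t) + (3 + k) * t ≡ (3 * k + 3) * t
        collect = solve-∀
        at-c : weight c ≡ 0
        at-c rewrite inside-self p c | doubled-self p c | *-zeroʳ den = refl

    balanced : ∃ λ p → ∀ i → Good p i
    balanced with locallyMaximal
    ... | p , maximal with any? (λ c → den * meet p c <? threshold)
    ...   | no  none = p , λ i → ≮⇒≥ λ bad → none (i , bad)
    ...   | yes (c , bad) with trim {c} (trimmable p (FirstPhase.others-good p maximal c bad) (FirstPhase.scaled-gain≤loss p maximal c bad))
    ...     | s , critical = part s , good
      where
      good : ∀ i → Good (part s) i
      good i with i ≟ c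
      ... | yes refl = SecondPhase.target-good s critical
      ... | no  i≢c  = others-good s i i≢c

-- Induction on the number of parts by deleting a heavy vertex.

-- The chain a / b ≤ c / d ≤ den / num with denominators cleared. It carries a ratio bound over to
-- one part fewer.
ratio-weaken : ∀ {a b c d num den} .{{_ : NonZero d}} → a * d ≤ b * c → c * num ≤ d * den → a * num ≤ b * den
ratio-weaken {a} {b} {c} {d} {num} {den} ad≤bc c≤d = *-cancelˡ-≤ d (begin
  d * (a * num)  ≡⟨ swap d a num ⟩
  a * d * num    ≤⟨ *-monoˡ-≤ num ad≤bc ⟩
  b * c * num    ≡⟨ *-assoc b c num ⟩
  b * (c * num)  ≤⟨ *-monoʳ-≤ b c≤d ⟩
  b * (d * den)  ≡⟨ swap′ b d den ⟩
  d * (b * den)  ∎)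
  where
  open ≤-Reasoning
  swap : ∀ d a x → d * (a * x) ≡ a * d * x
  swap = solve-∀
  swap′ : ∀ b d x → b * (d * x) ≡ d * (b * x)
  swap′ = solve-∀

open Incidence using (size; deg; hits; meet)

delete : (Fin m → Fin n → Bool) → Fin n → Fin m → Fin n → Bool
delete E v e u = E e u ∧ not (does (u ≟ v))

delete-other : (E : Fin m → Fin n → Bool) (v : Fin n) (e : Fin m) (u : Fin n) → u ≢ v → delete E v e u ≡ E e u
delete-other E v e u u≢v = trans (cong (λ b → E e u ∧ not b) (dec-false (u ≟ v) u≢v)) (∧-identityʳ (E e u))

size-delete : (E : Fin m → Fin n → Bool) (v : Fin n) (e : Fin m) → size E e ≤ suc (size (delete E v) e)
size-delete E v e = begin
  size E e                                ≤⟨ m≤m+n _ _ ⟩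
  size E e + ⟦ delete E v e v ⟧           ≡⟨ sum-update (λ u → ⟦ E e u ⟧) (λ u → ⟦ delete E v e u ⟧) v (λ u u≢v → cong ⟦_⟧ (sym (delete-other E v e u u≢v))) ⟩
  size (delete E v) e + ⟦ E e v ⟧         ≤⟨ +-monoʳ-≤ (size (delete E v) e) (⟦⟧≤1 (E e v)) ⟩
  size (delete E v) e + 1                 ≡⟨ +-comm _ 1 ⟩
  suc (size (delete E v) e)               ∎
  where open ≤-Reasoning

isPos-mono : ∀ {x y} → x ≤ y → isPos x ≤ isPos y
isPos-mono {zero}          _ = z≤n
isPos-mono {suc x} {suc y} _ = ≤-refl

isPos-⟦⟧ : ∀ b → ⟦ b ⟧ ≡ isPos ⟦ b ⟧
isPos-⟦⟧ false = refl
isPos-⟦⟧ true  = refl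

isolate : Fin n → Partition n r → Partition n (suc r)
isolate v p = updateAt (suc ∘ p) v (const zero)

meet-isolate-zero : (E : Fin m → Fin n → Bool) (v : Fin n) (p : Partition n r) → deg E v ≤ meet E (isolate v p) zero
meet-isolate-zero E v p = sum-mono-≤ λ e → ≤-trans (≤-reflexive (isPos-⟦⟧ (E e v))) (isPos-mono (begin
  ⟦ E e v ⟧                              ≡⟨ *-identityʳ _ ⟨
  ⟦ E e v ⟧ * 1                          ≡⟨ cong (⟦ E e v ⟧ *_) (δ-≡ (updateAt-updates v (suc ∘ p))) ⟨
  ⟦ E e v ⟧ * δ (isolate v p v) zero     ≤⟨ term-≤-sum (λ u → ⟦ E e u ⟧ * δ (isolate v p u) zero) v ⟩
  hits E (isolate v p) e zero            ∎))
  where open ≤-Reasoning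

-- No edge of `delete E v` contains `v`, so the part that `p` gave to `v` loses nothing when `v` is
-- set apart.
meet-isolate-suc : (E : Fin m → Fin n → Bool) (v : Fin n) (p : Partition n r) (i : Fin r) →
                   meet (delete E v) p i ≤ meet E (isolate v p) (suc i)
meet-isolate-suc E v p i = sum-mono-≤ λ e → isPos-mono (sum-mono-≤ (perVertex e))
  where
  perVertex : ∀ e u → ⟦ delete E v e u ⟧ * δ (p u) i ≤ ⟦ E e u ⟧ * δ (isolate v p u) (suc i)
  perVertex e u with u ≟ v
  ... | yes refl = ≤-trans (≤-reflexive (cong (λ b → ⟦ b ⟧ * δ (p v) i) (∧-zeroʳ (E e v)))) z≤n
  ... | no  u≢v  = ≤-reflexive (cong₂ (λ b j → ⟦ b ⟧ * δ j (suc i)) (∧-identityʳ (E e u)) (sym (updateAt-minimal u v (suc ∘ p) u≢v)))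

-- A heavy vertex becomes part `zero` and is deleted from the edges. Their number and the ratio stay
-- the same, and each size drops by at most one.
balanced-partition : ∀ k (E : Fin m → Fin n → Bool) (num den : ℕ) →
                     (3 * k + 1) * num ≤ (2 + k) * den → (3 * k + 3) * num ≤ (3 + k) * den →
                     (∀ e → suc k ≤ size E e) →
                     ∃ λ (p : Partition n (suc k)) → ∀ i → num * m ≤ den * meet E p i
balanced-partition {m} {n} zero E num den _ ratio₂ large = p , λ { zero → begin
    num * m                            ≤⟨ *-monoˡ-≤ m (*-cancelˡ-≤ {num} {den} 3 ratio₂) ⟩
    den * m                            ≡⟨ cong (den *_) (meet+avoid p zero) ⟨
    den * (meet E p zero + avoid p zero)  ≤⟨ *-monoʳ-≤ den (+-monoʳ-≤ (meet E p zero) none) ⟩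
    den * (meet E p zero + 0)          ≡⟨ cong (den *_) (+-identityʳ (meet E p zero)) ⟩
    den * meet E p zero                ∎ }
  where
  open ≤-Reasoning
  open Incidence E using (avoid; meet+avoid; avoid≤∑-doubled; doubled-self)
  p : Partition n 1
  p = const zero
  none : avoid p zero ≤ 0
  -- An edge avoiding the single part would need two vertices in some other part, and there is none.
  none = ≤-trans (avoid≤∑-doubled p zero large) (≤-reflexive (trans (+-identityʳ _) (doubled-self p zero)))
balanced-partition {m} {n} (suc k) E num den ratio₁ ratio₂ large with any? (λ v → num * m ≤? den * deg E v)
... | no  none = Balance.balanced E num den large (λ v → ≰⇒> λ heavy → none (v , heavy)) ratio₁ ratio₂
... | yes (v , heavy) with balanced-partition k (delete E v) num den
        (ratio-weaken {3 * k + 1} {2 + k} {3 * suc k + 1} {3 + k} {num} {den} (m+n≤o⇒m≤o _ (≤-reflexive (identity₁ k))) ratio₁)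
        (ratio-weaken {3 * k + 3} {3 + k} {3 * suc k + 3} {4 + k} {num} {den} (m+n≤o⇒m≤o _ (≤-reflexive (identity₂ k))) ratio₂)
        (λ e → ≤-pred (≤-trans (large e) (size-delete E v e)))
  where
  -- Cross-multiplied, the bounds (k + 2) / (3k + 1) and (k + 3) / (3k + 3) decrease as k grows; 5
  -- and 6 are the exact differences.
  identity₁ : ∀ k → (3 * k + 1) * (3 + k) + 5 ≡ (2 + k) * (3 * suc k + 1)
  identity₁ = solve-∀
  identity₂ : ∀ k → (3 * k + 3) * (4 + k) + 6 ≡ (3 + k) * (3 * suc k + 3)
  identity₂ = solve-∀
... | p , good = isolate v p , λ
  { zero    → ≤-trans heavy (*-monoʳ-≤ den (meet-isolate-zero E v p))
  ; (suc i) → ≤-trans (good i) (*-monoʳ-≤ den (meet-isolate-suc E v p i)) }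

-- Translation to multi-hypergraphs and the constants.

∣∣-sum : (e : Subset n) → ∣ e ∣ ≡ sum (λ v → ⟦ Vec.lookup e v ⟧)
∣∣-sum Vec.[]            = refl
∣∣-sum (true Vec.∷ e)  = cong suc (∣∣-sum e)
∣∣-sum (false Vec.∷ e) = ∣∣-sum e

incidence : (es : List (Subset n)) → Fin (length es) → Fin n → Bool
incidence es e = Vec.lookup (lookup es e)

meet≤meetCount : (p : Partition n r) (i : Fin r) (es : List (Subset n)) →
                 meet (incidence es) p i ≤ length (filter (meets? p i) es)
meet≤meetCount p i []       = z≤n
meet≤meetCount {n} p i (e ∷ es) with meets? p i e
... | yes _ = +-mono-≤ (isPos≤1 (hits (incidence (e ∷ es)) p zero i)) (meet≤meetCount p i es)
  where
  isPos≤1 : ∀ x → isPos x ≤ 1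
  isPos≤1 zero    = z≤n
  isPos≤1 (suc x) = ≤-refl
... | no ¬meets = ≤-trans (≤-reflexive (cong (λ x → isPos x + meet (incidence es) p i) unmet)) (meet≤meetCount p i es)
  where
  unmet : hits (incidence (e ∷ es)) p zero i ≡ 0
  unmet = trans (sum-cong-≗ perVertex) (sum-replicate-zero n)
    where
    perVertex : ∀ v → ⟦ Vec.lookup e v ⟧ * δ (p v) i ≡ 0
    perVertex v with Vec.lookup e v in eq | p v ≟ i
    ... | false | _        = refl
    ... | true  | no  _    = refl
    ... | true  | yes pv≡i = contradiction (v , lookup⇒[]= v e eq , pv≡i) ¬meets

AtLeastCrTimes-partition : ∀ k → (3 * k + 1) * cNum (suc k) ≤ (2 + k) * cDen (suc k) →
  (3 * k + 3) * cNum (suc k) ≤ (3 + k) * cDen (suc k) → (G : MultiHypergraph n (suc k)) →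
  Σ (Partition n (suc k)) λ p → (i : Fin (suc k)) → AtLeastCrTimes (suc k) (numEdges G) (meetCount G p i)
AtLeastCrTimes-partition k ratio₁ ratio₂ G
  with balanced-partition k (incidence (edges G)) (cNum (suc k)) (cDen (suc k)) ratio₁ ratio₂ large
  where
  large : ∀ e → suc k ≤ size (incidence (edges G)) e
  large e = ≤-reflexive (trans (sym (uniform G (∈-lookup e))) (∣∣-sum (lookup (edges G) e)))
... | p , good = p , λ i → ≤-trans (good i) (*-monoʳ-≤ (cDen (suc k)) (meet≤meetCount p i (edges G)))

theorem5 : (r : ℕ) → 2 ≤ r → (n : ℕ) → (G : MultiHypergraph n r) →
    Σ (Partition n r) λ p → (i : Fin r) →
    AtLeastCrTimes r (numEdges G) (meetCount G p i)
theorem5 1 (s≤s ()) n G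
-- For r = 2 and r = 3 the constant equals (r + 2) / (3r), so the second bound is an equality.
theorem5 2 _ n G = AtLeastCrTimes-partition 1 (m≤m+n 8 1) ≤-refl G
theorem5 3 _ n G = AtLeastCrTimes-partition 2 (m≤m+n 35 1) ≤-refl G
theorem5 (suc (suc (suc (suc j)))) _ n G = AtLeastCrTimes-partition (3 + j)
  (m+n≤o⇒m≤o _ (≤-reflexive (identity₁ j))) (m+n≤o⇒m≤o _ (≤-reflexive (identity₂ j))) G
  where
  -- The last factor is the normal form of `3 * (4 + j) ∸ 4`. Both bounds are equalities at r = 4,
  -- and the slack `j` or `2 * j` appears beyond it.
  identity₁ : ∀ j → (3 * (3 + j) + 1) * (4 + j) + j ≡ (5 + j) * (j + (4 + j + (4 + j + 0)))
  identity₁ = solve-∀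
  identity₂ : ∀ j → (3 * (3 + j) + 3) * (4 + j) + 2 * j ≡ (6 + j) * (j + (4 + j + (4 + j + 0)))
  identity₂ = solve-∀
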